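{- Let $\beta>1$ be a root of $x^d-a_{1}x^{d-1}+a_2x^{d-2}+\dots + (-1)^d a_d\in\mathbb{Z}[x]$ (that is, of $x^d+\sum_{i=1}^d(-1)^i a_i x^{d-i}$) with $a_i\ge 0$ for $i=1,\dots,d$, and $a_{1}\ge 2+\sum_{i=2}^{d} a_{i}$. Then $\beta$ has Property ($-$F).
   Context: For a real number $\beta>1$, set $\ell_\beta = \frac{ -\beta}{\beta+1}$ and define the $(-\beta)$-transformation $T_{ -\beta}: [\ell_\beta,\ell_\beta+1)\to[\ell_\beta,\ell_\beta+1)$ by $T_{ -\beta}(x) = -\beta x - \lfloor -\beta x-\ell_\beta\rfloor$. For $x\in[\ell_\beta,\ell_\beta+1)$ let $d_{ -\beta}(x)=x_1x_2x_3\cdots$ with $x_i = \lfloor -\beta T_{ -\beta}^{i-1}(x)-\ell_\beta\rfloor\in\{0,1,\dots,\lfloor\beta\rfloor\}$, so that $x=\sum_{i\ge1} x_i(-\beta)^{ -i}$. For $x\in\mathbb{R}$, let $k\ge 0$ be the minimal integer with $\frac{x}{(-\beta)^k}\in(\ell_\beta,\ell_\beta+1)$ and let $d_{ -\beta}(\frac{x}{(-\beta)^k})=x_1x_2x_3\cdots$; the $(-\beta)$-expansion of $x$ is $x_1\cdots x_k\bullet x_{k+1}x_{k+2}\cdots$ if $k\ge1$ and $0\bullet x_1x_2\cdots$ if $k=0$. It is finite if only finitely many digits are nonzero, i.e. if $T_{ -\beta}^n(\frac{x}{(-\beta)^k})=0$ for some $n\ge0$. The number $\beta$ has Property ($-$F)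 if each element of $\mathbb{Z}[\beta^{ -1}]$ has a finite $(-\beta)$-expansion. -}

module Defs where

open import Algebra.Bundles using (CommutativeRing; Semiring)
open import Data.Fin.Base using (toℕ)
open import Data.Integer.Base as ℤ using (ℤ; +_; -[1+_]; 0ℤ)
open import Data.List.Base using (List; []; _∷_; map; upTo)
open import Data.Nat.Base as ℕ using (ℕ; zero; suc)
open import Data.Nat.GeneralisedArithmetic using (fold)
open import Data.Product.Base using (∃; _×_; _,_; proj₁; proj₂)
open import Data.Sum.Base using (_⊎_; inj₁; inj₂)
open import Data.Vec.Functional using (Vector)
open import Level using (_⊔_) renaming (suc to lsuc)
open import Relation.Binary.Core using (Rel)
open import Relation.Binary.Definitions using (tri<; tri≈; tri>)
open import Relation.Binary.PropositionalEquality.Core using (_≡_)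
open import Relation.Binary.Structures using (IsStrictTotalOrder)
open import Relation.Nullary using (¬_; contradiction)

import Algebra.Definitions.RawMonoid as RawMonoidDefs
import Algebra.Definitions.RawSemiring as RawSemiringDefs
import Algebra.Properties.Monoid.Mult as MultProperties
import Algebra.Properties.Ring as RingProperties
import Data.Integer.Properties as ℤ
import Relation.Binary.Reasoning.Setoid as SetoidReasoning

-- The real numbers of classical mathematics, given axiomatically as a
-- Cauchy complete Archimedean ordered field; classically these axioms
-- determine ℝ up to unique isomorphism.  Trichotomy is among them, so
-- the order is decidable and the integer part is a function.  As _⁻¹ is
-- total, the value of 0# ⁻¹ is left unspecified.

record RealNumbers c ℓ₁ ℓ₂ : Set (lsuc (c ⊔ ℓ₁ ⊔ ℓ₂)) where
  infix  8 _⁻¹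
  infix  4 _<_ _≤_
  infixl 7 _/_

  field
    commutativeRing : CommutativeRing c ℓ₁

  open CommutativeRing commutativeRing public renaming (refl to ≈-refl)
  open RawSemiringDefs (Semiring.rawSemiring semiring) public
    using (_^_; sum) renaming (_×_ to _×ₙ_)

  field
    _<_                : Rel Carrier ℓ₂
    isStrictTotalOrder : IsStrictTotalOrder _≈_ _<_
    0<1                : 0# < 1#
    +-monoʳ-<          : ∀ x {y z} → y < z → x + y < x + z
    *-pos              : ∀ {x y} → 0# < x → 0# < y → 0# < x * y
    _⁻¹                : Carrier → Carrier
    ⁻¹-cong            : ∀ {x y} → x ≈ y → x ⁻¹ ≈ y ⁻¹
    ⁻¹-inverseʳ        : ∀ {x} → ¬ x ≈ 0# → x * x ⁻¹ ≈ 1#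
    archimedean        : ∀ x → ∃ λ n → x < n ×ₙ 1#

  _≤_ : Rel Carrier (ℓ₁ ⊔ ℓ₂)
  x ≤ y = x < y ⊎ x ≈ y

  _/_ : Carrier → Carrier → Carrier
  x / y = x * y ⁻¹

  IsCauchy : (ℕ → Carrier) → Set (c ⊔ ℓ₂)
  IsCauchy s = ∀ ε → 0# < ε → ∃ λ N → ∀ m n → N ℕ.≤ m → N ℕ.≤ n →
    s m - s n < ε

  _ConvergesTo_ : (ℕ → Carrier) → Carrier → Set (c ⊔ ℓ₂)
  s ConvergesTo x = ∀ ε → 0# < ε → ∃ λ N → ∀ n → N ℕ.≤ n →
    (s n - x < ε) × (x - s n < ε)

  field
    complete : ∀ s → IsCauchy s → ∃ λ x → s ConvergesTo x

  module STO = IsStrictTotalOrder isStrictTotalOrder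

  fromℤ : ℤ → Carrier
  fromℤ (+ n)    = n ×ₙ 1#
  fromℤ -[1+ n ] = - (suc n ×ₙ 1#)

  private
    open SetoidReasoning setoid
    open RingProperties ring using (-0#≈0#; -‿+-comm)
    open MultProperties +-monoid using (×-homo-+)

    <-resp : ∀ {w x y z} → w ≈ x → y ≈ z → w < y → x < z
    <-resp w≈x y≈z w<y =
      STO.<-respˡ-≈ w≈x (STO.<-respʳ-≈ y≈z w<y)

    -x+[x+y]≈y : ∀ x y → - x + (x + y) ≈ y
    -x+[x+y]≈y x y = begin
      - x + (x + y)  ≈⟨ +-assoc (- x) x y ⟨
      (- x + x) + y  ≈⟨ +-congʳ (-‿inverseˡ x) ⟩
      0# + y         ≈⟨ +-identityˡ y ⟩
      y              ∎

    fromℤ-suc : ∀ i → fromℤ (ℤ.suc i) ≈ fromℤ i + 1#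
    fromℤ-suc (+ n)        = +-comm 1# (n ×ₙ 1#)
    fromℤ-suc -[1+ zero ]  = sym (begin
      - (1# + 0#) + 1#  ≈⟨ +-congʳ (-‿cong (+-identityʳ 1#)) ⟩
      - 1# + 1#         ≈⟨ -‿inverseˡ 1# ⟩
      0#                ∎)
    fromℤ-suc -[1+ suc n ] = sym (begin
      - (1# + u) + 1#     ≈⟨ +-congʳ (-‿+-comm 1# u) ⟨
      (- 1# + - u) + 1#   ≈⟨ +-assoc (- 1#) (- u) 1# ⟩
      - 1# + (- u + 1#)   ≈⟨ +-congˡ (+-comm (- u) 1#) ⟩
      - 1# + (1# + - u)   ≈⟨ -x+[x+y]≈y 1# (- u) ⟩
      - u                 ∎)
      where u = suc n ×ₙ 1#

    fromℤ-neg : ∀ n → fromℤ (ℤ.- (+ n)) ≈ - (n ×ₙ 1#)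
    fromℤ-neg zero    = sym -0#≈0#
    fromℤ-neg (suc n) = ≈-refl

    search : ∀ x k i → fromℤ i ≤ x → x < fromℤ i + k ×ₙ 1# →
             ∃ λ j → fromℤ j ≤ x × x < fromℤ j + 1#
    search x zero    i (inj₁ i<x) x<i =
      contradiction (STO.trans i<x (STO.<-respʳ-≈ (+-identityʳ _) x<i))
                    (STO.irrefl ≈-refl)
    search x zero    i (inj₂ i≈x) x<i =
      contradiction (STO.<-respʳ-≈ (+-identityʳ _) x<i) (STO.irrefl (sym i≈x))
    search x (suc k) i i≤x x<i+k with STO.compare x (fromℤ i + 1#)
    ... | tri< x<i+1 _ _ = i , i≤x , x<i+1
    ... | tri≈ _ x≈i+1 _ = search x k (ℤ.suc i)
      (inj₂ (trans (fromℤ-suc i) (sym x≈i+1)))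
      (STO.<-respʳ-≈ (trans (sym (+-assoc _ _ _)) (+-congʳ (sym (fromℤ-suc i)))) x<i+k)
    ... | tri> _ _ i+1<x = search x k (ℤ.suc i)
      (inj₁ (STO.<-respˡ-≈ (sym (fromℤ-suc i)) i+1<x))
      (STO.<-respʳ-≈ (trans (sym (+-assoc _ _ _)) (+-congʳ (sym (fromℤ-suc i)))) x<i+k)

  integerPart : ∀ x → ∃ λ j → fromℤ j ≤ x × x < fromℤ j + 1#
  integerPart x with archimedean x | archimedean (- x)
  ... | n , x<n | m , -x<m = search x (m ℕ.+ n) (ℤ.- (+ m)) (inj₁ lower) upper
    where
    a = m ×ₙ 1#
    b = n ×ₙ 1#

    lower : fromℤ (ℤ.- (+ m)) < x
    lower = <-resp
      (begin
        (- a + x) + - x  ≈⟨ +-assoc (- a) x (- x) ⟩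
        - a + (x + - x)  ≈⟨ +-congˡ (-‿inverseʳ x) ⟩
        - a + 0#         ≈⟨ +-identityʳ (- a) ⟩
        - a              ≈⟨ fromℤ-neg m ⟨
        fromℤ (ℤ.- (+ m)) ∎)
      (begin
        (- a + x) + a    ≈⟨ +-assoc (- a) x a ⟩
        - a + (x + a)    ≈⟨ +-congˡ (+-comm x a) ⟩
        - a + (a + x)    ≈⟨ -x+[x+y]≈y a x ⟩
        x                ∎)
      (+-monoʳ-< (- a + x) -x<m)

    upper : x < fromℤ (ℤ.- (+ m)) + (m ℕ.+ n) ×ₙ 1#
    upper = STO.<-respʳ-≈
      (sym (begin
        fromℤ (ℤ.- (+ m)) + (m ℕ.+ n) ×ₙ 1#  ≈⟨ +-cong (fromℤ-neg m) (×-homo-+ 1# m n) ⟩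
        - a + (a + b)                        ≈⟨ -x+[x+y]≈y a b ⟩
        b                                    ∎))
      x<n

  ⌊_⌋ : Carrier → ℤ
  ⌊ x ⌋ = proj₁ (integerPart x)

  ⌊⌋-≤ : ∀ x → fromℤ ⌊ x ⌋ ≤ x
  ⌊⌋-≤ x = proj₁ (proj₂ (integerPart x))

  ⌊⌋-< : ∀ x → x < fromℤ ⌊ x ⌋ + 1#
  ⌊⌋-< x = proj₂ (proj₂ (integerPart x))

  -- Value at y of the polynomial with coefficients c₀ ∷ c₁ ∷ …

  evaluate : List ℤ → Carrier → Carrier
  evaluate []       y = 0#
  evaluate (c ∷ cs) y = fromℤ c + y * evaluate cs y

  _∈ℤ[_] : Carrier → Carrier → Set ℓ₁
  x ∈ℤ[ y ] = ∃ λ cs → x ≈ evaluate cs y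

  -- xᵈ + ∑ᵢ (-1)ⁱ aᵢ xᵈ⁻ⁱ for 1 ≤ i ≤ d, where aᵢ is stored at index i - 1

  alternatingPolynomial : ∀ {d} → Vector ℤ d → Carrier → Carrier
  alternatingPolynomial {d} a x =
    x ^ d + sum (λ i → (- 1#) ^ suc (toℕ i) * fromℤ (a i) * x ^ (d ℕ.∸ suc (toℕ i)))

sumℤ : ∀ {n} → Vector ℤ n → ℤ
sumℤ = RawMonoidDefs.sum ℤ.+-0-rawMonoid

-- x₁⋯xₖ • xₖ₊₁xₖ₊₂⋯

record DigitString : Set where
  constructor _•_
  field
    integerDigits    : List ℤ
    fractionalDigits : ℕ → ℤ

open DigitString public

-- The integer digits form a list, so only the digits after the point matter.

OnlyFinitelyManyNonzero : DigitString → Set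
OnlyFinitelyManyNonzero e = ∃ λ N → ∀ j → N ℕ.≤ j → fractionalDigits e j ≡ 0ℤ

module NegativeBase {c ℓ₁ ℓ₂} (ℝ : RealNumbers c ℓ₁ ℓ₂)
                    (β : RealNumbers.Carrier ℝ) where
  open RealNumbers ℝ

  ℓᵦ : Carrier
  ℓᵦ = (- β) / (β + 1#)

  -- T₋ᵦ and the digits are defined for all reals; they are only used on
  -- [ℓᵦ, ℓᵦ + 1), which T₋ᵦ maps to itself.

  T₋ᵦ : Carrier → Carrier
  T₋ᵦ x = - β * x - fromℤ ⌊ - β * x - ℓᵦ ⌋

  -- digit y i is the digit yᵢ₊₁ of d₋ᵦ(y) = y₁y₂y₃⋯

  digit : Carrier → ℕ → ℤ
  digit y i = ⌊ - β * fold y T₋ᵦ i - ℓᵦ ⌋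

  scaled : Carrier → ℕ → Carrier
  scaled x k = x / ((- β) ^ k)

  InRange : Carrier → ℕ → Set ℓ₂
  InRange x k = ℓᵦ < scaled x k × scaled x k < ℓᵦ + 1#

  IsMinimalExponent : Carrier → ℕ → Set ℓ₂
  IsMinimalExponent x k = InRange x k × (∀ j → InRange x j → k ℕ.≤ j)

  expansionWith : Carrier → ℕ → DigitString
  expansionWith x zero      = (0ℤ ∷ []) • digit (scaled x 0)
  expansionWith x k@(suc _) =
    map (digit (scaled x k)) (upTo k) • λ j → digit (scaled x k) (k ℕ.+ j)

  HasFiniteExpansion : Carrier → Set ℓ₂
  HasFiniteExpansion x =
    ∃ λ k → IsMinimalExponent x k × OnlyFinitelyManyNonzero (expansionWith x k)

  PropertyMinusF : Set (c ⊔ ℓ₁ ⊔ ℓ₂)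
  PropertyMinusF = ∀ x → x ∈ℤ[ β ⁻¹ ] → HasFiniteExpansion x

module Submission where

-- Put w₁ = 1 and wⱼ₊₁ = aⱼ - β wⱼ, so that w_{d+1} = 0 because β is a root.
-- Every integer combination z = ∑ hⱼ wⱼ satisfies T₋ᵦ z = i w₁ + ∑ hⱼ wⱼ₊₁ for
-- some integer i: the orbit shifts the coefficients and prepends new ones.  Let P
-- and N be the sums of the positive and negative parts of w₂, w₃, ….  From aᵢ ≥ 0
-- and a₁ ≥ 2 + ∑ᵢ≥₂ aᵢ one gets (β + 1) N < 1 and (β + 1) (P + N) < β, and since
-- -β ≤ (β + 1) T₋ᵦ z < 1, coefficients in [-m-1, m+1] are followed by ones in
-- [-m-1, m], which in turn are followed by ones in [-m, m].  So the orbit of z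
-- reaches 0.  If x ∈ ℤ[β⁻¹], then (-β)ᵏ x is such a combination for some k, and
-- so is T₋ᵦᵏ x.

open import Defs
open import Data.Nat.Base as ℕ using (ℕ; zero; suc)
open import Data.Integer.Base as ℤ using (ℤ; +_; -[1+_]; 0ℤ)
open import Data.Vec.Functional using (Vector; head; tail)

open import Algebra.Solver.Ring.AlmostCommutativeRing
  using (fromCommutativeRing; _-Raw-AlmostCommutative⟶_)
open import Data.Fin.Base as Fin using (Fin; toℕ)
open import Data.List.Base using ([]; _∷_; length)
open import Data.Maybe.Base using (Maybe; just; nothing)
open import Data.Nat.GeneralisedArithmetic using (fold; fold-+)
open import Data.Product.Base using (∃; _×_; _,_; proj₁; proj₂)
open import Data.Sum.Base using (_⊎_; inj₁; inj₂)
open import Function.Base using (_∘_)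
open import Level using (_⊔_)
open import Relation.Binary.Definitions using (tri<; tri≈; tri>)
open import Relation.Binary.PropositionalEquality as ≡ using (_≡_)
open import Relation.Nullary using (¬_; Dec; yes; no; contradiction)
open import Relation.Nullary.Decidable using (_×-dec_)

import Algebra.Properties.Ring as RingProperties
import Algebra.Properties.Semiring.Exp as ExpProperties
import Algebra.Properties.Semiring.Mult as MultProperties
import Algebra.Properties.Semiring.Sum as SumProperties
import Algebra.Solver.Ring as RingSolver
import Data.Integer.Properties as ℤ
import Data.Nat.Properties as ℕ
import Relation.Binary.Reasoning.Setoid as SetoidReasoning

-- Integer intervals around zero.

Between : ℕ → ℕ → ℤ → Set
Between m k i = ℤ.- + m ℤ.≤ i × i ℤ.≤ + k

Between-weaken : ∀ {m m′ k k′ i} → m ℕ.≤ m′ → k ℕ.≤ k′ → Between m k i → Between m′ k′ i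
Between-weaken m≤m′ k≤k′ (-m≤i , i≤k) =
  ℤ.≤-trans (ℤ.neg-mono-≤ (ℤ.+≤+ m≤m′)) -m≤i , ℤ.≤-trans i≤k (ℤ.+≤+ k≤k′)

Between-∣∣ : ∀ i → Between ℤ.∣ i ∣ ℤ.∣ i ∣ i
Between-∣∣ (+ m)    = ℤ.neg-≤-pos , ℤ.≤-refl
Between-∣∣ -[1+ m ] = ℤ.≤-refl , ℤ.-≤+

Between-bound : ∀ k (h : ℕ → ℤ) → ∃ λ m → ∀ j → j ℕ.< k → Between m m (h j)
Between-bound zero    h = 0 , λ _ ()
Between-bound (suc k) h with Between-bound k (h ∘ suc)
... | m , b = ℤ.∣ h 0 ∣ ℕ.⊔ m , bounds
  where
  bounds : ∀ j → j ℕ.< suc k → Between (ℤ.∣ h 0 ∣ ℕ.⊔ m) (ℤ.∣ h 0 ∣ ℕ.⊔ m) (h j)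
  bounds zero    _   = Between-weaken (ℕ.m≤m⊔n _ m) (ℕ.m≤m⊔n _ m) (Between-∣∣ (h 0))
  bounds (suc j) j<k = Between-weaken m≤ m≤ (b j (ℕ.s<s⁻¹ j<k))
    where m≤ = ℕ.m≤n⊔m ℤ.∣ h 0 ∣ m

-- Iteration of a map and least witnesses.

module _ {c} {A : Set c} (T : A → A) where

  -- The index of `Q` counts the denominators -β still to be cleared; each application of `T`
  -- removes one.
  fold-descend : ∀ {ℓ} (Q : ℕ → A → Set ℓ) → (∀ k {z} → Q (suc k) z → Q k (T z)) →
                 ∀ k {z} → Q k z → ∃ λ m → Q 0 (fold z T m)
  fold-descend Q step zero    q = 0 , q
  fold-descend Q step (suc k) {z} q =
    let m , q₀ = fold-descend Q step k (step k q)
    in m ℕ.+ 1 , ≡.subst (Q 0) (≡.sym (fold-+ z T m)) q₀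

  fold-preserves : ∀ {ℓ} (Q : A → Set ℓ) → (∀ {z} → Q z → Q (T z)) →
                   ∀ {z m} → Q (fold z T m) → ∀ n → m ℕ.≤ n → Q (fold z T n)
  fold-preserves Q step {z} {m} q n m≤n = go (ℕ.≤⇒≤′ m≤n)
    where
    go : ∀ {n} → m ℕ.≤′ n → Q (fold z T n)
    go (ℕ.≤′-reflexive ≡.refl) = q
    go (ℕ.≤′-step m≤n)         = step (go m≤n)

least : ∀ {p} {P : ℕ → Set p} → (∀ n → Dec (P n)) → ∀ n → P n →
        ∃ λ k → P k × (∀ j → P j → k ℕ.≤ j)
least P? zero    p = 0 , p , λ _ _ → ℕ.z≤n
least {P = P} P? (suc n) p with P? 0
... | yes p₀ = 0 , p₀ , λ _ _ → ℕ.z≤n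
... | no ¬p₀ with least (P? ∘ suc) n p
...   | k , pₖ , k≤ = suc k , pₖ , suc-k≤
  where
  suc-k≤ : ∀ j → P j → suc k ℕ.≤ j
  suc-k≤ zero    p₀ = contradiction p₀ ¬p₀
  suc-k≤ (suc j) pⱼ = ℕ.s≤s (k≤ j pⱼ)

-- Descent on the size of the coefficients along an orbit.

infixr 5 _∷ₛ_

_∷ₛ_ : ℤ → (ℕ → ℤ) → ℕ → ℤ
(i ∷ₛ h) zero    = i
(i ∷ₛ h) (suc j) = h j

module _ {c ℓ} {A : Set c} (_represents_ : A → (ℕ → ℤ) → Set ℓ) where

  -- Only a window of `d` entries is bounded. The later entries of `h` record older coefficients
  -- that no longer affect the represented number.
  RepresentedBy : ℕ → (ℤ → Set) → A → Set ℓ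
  RepresentedBy d B z = ∃ λ h → z represents h × (∀ j → j ℕ.< d → B (h j))

  module _ (T : A → A) (shift : ∀ {z h} → z represents h → ∃ λ i → T z represents (i ∷ₛ h)) where

    -- A window of `suc d` entries representing `T y` consists of the new `i` and `d` entries of
    -- `h`; the oldest coefficient of `y` has left it. Hence `d` bounds have to suffice.
    NewestCoefficient : ℕ → (ℤ → Set) → (ℤ → Set) → Set (c ⊔ ℓ)
    NewestCoefficient d B B′ =
      ∀ y i h → T y represents (i ∷ₛ h) → (∀ j → j ℕ.< d → B (h j)) → B′ i

    -- After `suc d` steps every entry of the window is new. Until then the window mixes new entries
    -- in `B′` with old ones in `B`, and `B′⊆B` keeps all of it in `B`, as `newest` requires.
    tighten : ∀ {d B B′} → (∀ {i} → B′ i → B i) → NewestCoefficient d B B′ →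
              ∀ {z} → RepresentedBy (suc d) B z → RepresentedBy (suc d) B′ (fold z T (suc d))
    tighten {d} {B} {B′} B′⊆B newest {z} (h₀ , z∈ , b₀) =
      let h , Tz∈ , b′ , _ = iterates (suc d) in h , Tz∈ , b′
      where
      iterates : ∀ k → ∃ λ h → fold z T k represents h × (∀ j → j ℕ.< k → B′ (h j)) ×
                       (∀ j → j ℕ.< suc d → B (h j))
      iterates zero    = h₀ , z∈ , (λ _ ()) , b₀
      iterates (suc k) with iterates k
      ... | h , y∈ , b′ , b with shift y∈
      ... | i , Ty∈ = i ∷ₛ h , Ty∈ , b′-∷ , b-∷
        where
        b′-head : B′ i
        b′-head = newest (fold z T k) i h Ty∈ (λ j j<d → b j (ℕ.m<n⇒m<1+n j<d))
        b′-∷ : ∀ j → j ℕ.< suc k → B′ ((i ∷ₛ h) j)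
        b′-∷ zero    _   = b′-head
        b′-∷ (suc j) j<k = b′ j (ℕ.s<s⁻¹ j<k)
        b-∷ : ∀ j → j ℕ.< suc d → B ((i ∷ₛ h) j)
        b-∷ zero    _   = B′⊆B b′-head
        b-∷ (suc j) j<d = b j (ℕ.m<n⇒m<1+n (ℕ.s<s⁻¹ j<d))

    -- Two rounds of `tighten` lower the bound by one: the first improves the upper end, and the
    -- second needs that improvement to raise the lower end.
    descent : ∀ {d} → (∀ m → NewestCoefficient d (Between (suc m) (suc m)) (Between (suc m) m)) →
              (∀ m → NewestCoefficient d (Between (suc m) m) (Between m m)) →
              ∀ m {z} → RepresentedBy (suc d) (Between m m) z →
              ∃ λ k → RepresentedBy (suc d) (Between 0 0) (fold z T k)
    descent wide narrow zero    z∈ = 0 , z∈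
    descent {d} wide narrow (suc m) {z} z∈ =
      let k , Tz∈ = descent wide narrow m
            (tighten (Between-weaken (ℕ.n≤1+n m) ℕ.≤-refl) (narrow m)
            (tighten (Between-weaken ℕ.≤-refl (ℕ.n≤1+n m)) (wide m) z∈))
      in k ℕ.+ (suc d ℕ.+ suc d) ,
         ≡.subst (RepresentedBy (suc d) (Between 0 0))
           (≡.sym (≡.trans (fold-+ z T k) (≡.cong (λ y → fold y T k) (fold-+ z T (suc d))))) Tz∈

module _ {c ℓ₁ ℓ₂} (ℝ : RealNumbers c ℓ₁ ℓ₂) where
  open RealNumbers ℝ
  open RingProperties ring
    using (-0#≈0#; -‿+-comm; -‿involutive; -‿distribˡ-*; -‿distribʳ-*)
  open MultProperties semiring using (×-homo-+)
  open ExpProperties semiring using (^-congˡ; ^-homo-*; ^-assocʳ)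
  open SumProperties semiring using (*-distribˡ-sum; sum-cong-≋)
  open SetoidReasoning setoid

  -- The ring homomorphism from the integers to the reals.

  fromℤ-⊖ : ∀ m n → fromℤ (m ℤ.⊖ n) ≈ m ×ₙ 1# - n ×ₙ 1#
  fromℤ-⊖ m       zero    = sym (trans (+-congˡ -0#≈0#) (+-identityʳ _))
  fromℤ-⊖ zero    (suc n) = sym (+-identityˡ _)
  fromℤ-⊖ (suc m) (suc n) = begin
    fromℤ (suc m ℤ.⊖ suc n)   ≡⟨ ≡.cong fromℤ (ℤ.[1+m]⊖[1+n]≡m⊖n m n) ⟩
    fromℤ (m ℤ.⊖ n)           ≈⟨ fromℤ-⊖ m n ⟩
    x - y                     ≈⟨ +-identityˡ _ ⟨
    0# + (x - y)              ≈⟨ +-congʳ (-‿inverseʳ 1#) ⟨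
    1# - 1# + (x - y)         ≈⟨ +-assoc _ _ _ ⟩
    1# + (- 1# + (x - y))     ≈⟨ +-congˡ (+-comm _ _) ⟩
    1# + (x - y + - 1#)       ≈⟨ +-congˡ (+-assoc _ _ _) ⟩
    1# + (x + (- y + - 1#))   ≈⟨ +-assoc _ _ _ ⟨
    1# + x + (- y + - 1#)     ≈⟨ +-congˡ (+-comm _ _) ⟩
    1# + x + (- 1# + - y)     ≈⟨ +-congˡ (-‿+-comm 1# y) ⟩
    1# + x - (1# + y)         ∎
    where
    x = m ×ₙ 1#
    y = n ×ₙ 1#

  fromℤ-neg : ∀ i → fromℤ (ℤ.- i) ≈ - fromℤ i
  fromℤ-neg (+ zero)  = sym -0#≈0#
  fromℤ-neg (+ suc n) = ≈-refl
  fromℤ-neg -[1+ n ]  = sym (-‿involutive _)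

  fromℤ-+ : ∀ i j → fromℤ (i ℤ.+ j) ≈ fromℤ i + fromℤ j
  fromℤ-+ (+ m)    (+ n)    = ×-homo-+ 1# m n
  fromℤ-+ (+ m)    -[1+ n ] = fromℤ-⊖ m (suc n)
  fromℤ-+ -[1+ m ] (+ n)    = trans (fromℤ-⊖ n (suc m)) (+-comm _ _)
  fromℤ-+ -[1+ m ] -[1+ n ] = begin
    - (suc (suc (m ℕ.+ n)) ×ₙ 1#)      ≡⟨ ≡.cong (λ k → - (suc k ×ₙ 1#)) (≡.sym (ℕ.+-suc m n)) ⟩
    - ((suc m ℕ.+ suc n) ×ₙ 1#)        ≈⟨ -‿cong (×-homo-+ 1# (suc m) (suc n)) ⟩
    - (suc m ×ₙ 1# + suc n ×ₙ 1#)      ≈⟨ -‿+-comm _ _ ⟨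
    - (suc m ×ₙ 1#) - suc n ×ₙ 1#      ∎

  private
    fromℤ-*-+ : ∀ m j → fromℤ (+ m ℤ.* j) ≈ m ×ₙ 1# * fromℤ j
    fromℤ-*-+ zero    j = trans (reflexive (≡.cong fromℤ (ℤ.*-zeroˡ j))) (sym (zeroˡ _))
    fromℤ-*-+ (suc m) j = begin
      fromℤ (+ suc m ℤ.* j)          ≡⟨ ≡.cong fromℤ (ℤ.suc-* (+ m) j) ⟩
      fromℤ (j ℤ.+ + m ℤ.* j)        ≈⟨ fromℤ-+ j _ ⟩
      fromℤ j + fromℤ (+ m ℤ.* j)    ≈⟨ +-cong (sym (*-identityˡ _)) (fromℤ-*-+ m j) ⟩
      1# * fromℤ j + m ×ₙ 1# * fromℤ j ≈⟨ distribʳ _ _ _ ⟨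
      suc m ×ₙ 1# * fromℤ j          ∎

  fromℤ-* : ∀ i j → fromℤ (i ℤ.* j) ≈ fromℤ i * fromℤ j
  fromℤ-* (+ m)    j = fromℤ-*-+ m j
  fromℤ-* -[1+ m ] j = begin
    fromℤ (-[1+ m ] ℤ.* j)           ≡⟨ ≡.cong fromℤ (ℤ.neg-distribˡ-* (+ suc m) j) ⟨
    fromℤ (ℤ.- (+ suc m ℤ.* j))      ≈⟨ fromℤ-neg (+ suc m ℤ.* j) ⟩
    - fromℤ (+ suc m ℤ.* j)          ≈⟨ -‿cong (fromℤ-*-+ (suc m) j) ⟩
    - (suc m ×ₙ 1# * fromℤ j)        ≈⟨ -‿distribˡ-* _ _ ⟩
    - (suc m ×ₙ 1#) * fromℤ j        ∎

  -- fromℤ with the constant 1 mapped to 1# itself instead of 1# + 0#, so that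
  -- the solver's constants match the goals syntactically.
  private
    coefficient : ℤ → Carrier
    coefficient (+ 1) = 1#
    coefficient i     = fromℤ i

    coefficient≈fromℤ : ∀ i → coefficient i ≈ fromℤ i
    coefficient≈fromℤ (+ 0)           = ≈-refl
    coefficient≈fromℤ (+ 1)           = sym (+-identityʳ 1#)
    coefficient≈fromℤ (+ suc (suc n)) = ≈-refl
    coefficient≈fromℤ -[1+ n ]        = ≈-refl

    morphism : ℤ.+-*-rawRing -Raw-AlmostCommutative⟶ fromCommutativeRing commutativeRing
    morphism = record
      { ⟦_⟧    = coefficient
      ; +-homo = λ i j → lift₂ (i ℤ.+ j) i j +-cong (fromℤ-+ i j)
      ; *-homo = λ i j → lift₂ (i ℤ.* j) i j *-cong (fromℤ-* i j)
      ; -‿homo = λ i → trans (coefficient≈fromℤ (ℤ.- i))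
          (trans (fromℤ-neg i) (-‿cong (sym (coefficient≈fromℤ i))))
      ; 0-homo = ≈-refl
      ; 1-homo = ≈-refl
      }
      where
      lift₂ : ∀ k i j {_∙_ : Carrier → Carrier → Carrier} →
              (∀ {w x y z} → w ≈ x → y ≈ z → (w ∙ y) ≈ (x ∙ z)) →
              fromℤ k ≈ fromℤ i ∙ fromℤ j →
              coefficient k ≈ coefficient i ∙ coefficient j
      lift₂ k i j ∙-cong eq = trans (coefficient≈fromℤ k)
        (trans eq (sym (∙-cong (coefficient≈fromℤ i) (coefficient≈fromℤ j))))

    coefficient-≟ : ∀ i j → Maybe (coefficient i ≈ coefficient j)
    coefficient-≟ i j with i ℤ.≟ j
    ... | yes ≡.refl = just ≈-refl
    ... | no  _      = nothing

    open RingSolver ℤ.+-*-rawRing (fromCommutativeRing commutativeRing) morphism coefficient-≟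
      using (solve; _:=_; _:+_; _:*_; _:-_; :-_; con)


  -- Order arithmetic and integer parts.

  <-resp : ∀ {w x y z} → w ≈ x → y ≈ z → w < y → x < z
  <-resp w≈x y≈z w<y = STO.<-respˡ-≈ w≈x (STO.<-respʳ-≈ y≈z w<y)

  0<-resp : ∀ {x y} → x ≈ y → 0# < x → 0# < y
  0<-resp = STO.<-respʳ-≈

  0≤-resp : ∀ {x y} → x ≈ y → 0# ≤ x → 0# ≤ y
  0≤-resp x≈y (inj₁ 0<x) = inj₁ (0<-resp x≈y 0<x)
  0≤-resp x≈y (inj₂ 0≈x) = inj₂ (trans 0≈x x≈y)

  -- Inequalities are carried as signs of differences: a bound then follows from a ring identity
  -- that writes the difference as a sum of nonnegative terms.
  x<y⇒0<y-x : ∀ {x y} → x < y → 0# < y - x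
  x<y⇒0<y-x {x} {y} x<y =
    <-resp (-‿inverseˡ x) (+-comm (- x) y) (+-monoʳ-< (- x) x<y)

  0<y-x⇒x<y : ∀ {x y} → 0# < y - x → x < y
  0<y-x⇒x<y {x} {y} 0<y-x = <-resp (+-identityʳ x)
    (solve 2 (λ x y → x :+ (y :- x) := y) ≈-refl x y)
    (+-monoʳ-< x 0<y-x)

  x≤y⇒0≤y-x : ∀ {x y} → x ≤ y → 0# ≤ y - x
  x≤y⇒0≤y-x         (inj₁ x<y) = inj₁ (x<y⇒0<y-x x<y)
  x≤y⇒0≤y-x {x} {y} (inj₂ x≈y) = inj₂ (sym (trans (+-congʳ (sym x≈y)) (-‿inverseʳ x)))

  0≤y-x⇒x≤y : ∀ {x y} → 0# ≤ y - x → x ≤ y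
  0≤y-x⇒x≤y         (inj₁ 0<y-x) = inj₁ (0<y-x⇒x<y 0<y-x)
  0≤y-x⇒x≤y {x} {y} (inj₂ 0≈y-x) = inj₂ (begin
    x            ≈⟨ +-identityʳ x ⟨
    x + 0#       ≈⟨ +-congˡ 0≈y-x ⟩
    x + (y - x)  ≈⟨ solve 2 (λ x y → x :+ (y :- x) := y) ≈-refl x y ⟩
    y            ∎)

  <⇒≱ : ∀ {x y} → x < y → ¬ y ≤ x
  <⇒≱ x<y (inj₁ y<x) = STO.irrefl ≈-refl (STO.trans x<y y<x)
  <⇒≱ x<y (inj₂ y≈x) = STO.irrefl (sym y≈x) x<y

  0≤0 : 0# ≤ 0#
  0≤0 = inj₂ ≈-refl

  0≤1 : 0# ≤ 1#
  0≤1 = inj₁ 0<1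

  0≤x⇒0<y⇒0<x+y : ∀ {x y} → 0# ≤ x → 0# < y → 0# < x + y
  0≤x⇒0<y⇒0<x+y {x} {y} (inj₁ 0<x) 0<y =
    STO.trans 0<x (<-resp (+-identityʳ x) ≈-refl (+-monoʳ-< x 0<y))
  0≤x⇒0<y⇒0<x+y {x} {y} (inj₂ 0≈x) 0<y =
    0<-resp (trans (sym (+-identityˡ y)) (+-congʳ 0≈x)) 0<y

  0<x⇒0≤y⇒0<x+y : ∀ {x y} → 0# < x → 0# ≤ y → 0# < x + y
  0<x⇒0≤y⇒0<x+y 0<x 0≤y = 0<-resp (+-comm _ _) (0≤x⇒0<y⇒0<x+y 0≤y 0<x)

  0≤-+ : ∀ {x y} → 0# ≤ x → 0# ≤ y → 0# ≤ x + y
  0≤-+ 0≤x        (inj₁ 0<y) = inj₁ (0≤x⇒0<y⇒0<x+y 0≤x 0<y)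
  0≤-+ {x} 0≤x (inj₂ 0≈y) =
    0≤-resp (trans (sym (+-identityʳ x)) (+-congˡ 0≈y)) 0≤x

  0≤-* : ∀ {x y} → 0# ≤ x → 0# ≤ y → 0# ≤ x * y
  0≤-* (inj₁ 0<x) (inj₁ 0<y) = inj₁ (*-pos 0<x 0<y)
  0≤-* {x} {y} (inj₂ 0≈x) _  = inj₂ (trans (sym (zeroˡ y)) (*-congʳ 0≈x))
  0≤-* {x} {y} _ (inj₂ 0≈y)  = inj₂ (trans (sym (zeroʳ x)) (*-congˡ 0≈y))

  -- Replaces division: bounds are proved after multiplication by a positive quantity such as β + 1,
  -- which is cancelled here.
  0<x⇒0<xy⇒0<y : ∀ {x y} → 0# < x → 0# < x * y → 0# < y
  0<x⇒0<xy⇒0<y {x} {y} 0<x 0<xy with STO.compare 0# y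
  ... | tri< 0<y _ _ = 0<y
  ... | tri≈ _ 0≈y _ = contradiction (trans (sym (zeroʳ x)) (*-congˡ 0≈y))
                                     (λ 0≈xy → STO.irrefl 0≈xy 0<xy)
  ... | tri> _ _ y<0 = contradiction (0≤-* (inj₁ 0<x) (inj₁ (x<y⇒0<y-x y<0)))
    (<⇒≱ (0<y-x⇒x<y (0<-resp
      (solve 2 (λ x y → x :* y := con 0ℤ :- x :* (con 0ℤ :- y)) ≈-refl x y) 0<xy)))

  0≤n×1 : ∀ n → 0# ≤ n ×ₙ 1#
  0≤n×1 zero    = 0≤0
  0≤n×1 (suc n) = 0≤-+ 0≤1 (0≤n×1 n)

  0≤fromℤ : ∀ {i} → 0ℤ ℤ.≤ i → 0# ≤ fromℤ i
  0≤fromℤ {+ n} _ = 0≤n×1 n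

  fromℤ-minus : ∀ i j → fromℤ (i ℤ.- j) ≈ fromℤ i - fromℤ j
  fromℤ-minus i j = trans (fromℤ-+ i (ℤ.- j)) (+-congˡ (fromℤ-neg j))

  fromℤ-mono-≤ : ∀ {i j} → i ℤ.≤ j → fromℤ i ≤ fromℤ j
  fromℤ-mono-≤ {i} {j} i≤j =
    0≤y-x⇒x≤y (0≤-resp (fromℤ-minus j i) (0≤fromℤ (ℤ.i≤j⇒0≤j-i i≤j)))

  fromℤ-cancel-< : ∀ {i j} → fromℤ i < fromℤ j → i ℤ.< j
  fromℤ-cancel-< {i} {j} i<j = ℤ.≰⇒> (λ j≤i → <⇒≱ i<j (fromℤ-mono-≤ j≤i))

  fromℤ-1 : fromℤ (+ 1) ≈ 1#
  fromℤ-1 = +-identityʳ 1#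

  ≤-<-trans : ∀ {x y z} → x ≤ y → y < z → x < z
  ≤-<-trans (inj₁ x<y) y<z = STO.trans x<y y<z
  ≤-<-trans (inj₂ x≈y) y<z = STO.<-respˡ-≈ (sym x≈y) y<z

  -- The defining inequalities of the floor give ⌊x⌋ < 1 and 0 < ⌊x⌋ + 1, which leave only one
  -- integer.
  ⌊⌋≡0 : ∀ {x} → 0# < x → x < 1# → ⌊ x ⌋ ≡ 0ℤ
  ⌊⌋≡0 {x} 0<x x<1 = ℤ.≤-antisym
    (ℤ.i<j⇒i≤pred[j] {⌊ x ⌋} {+ 1} (fromℤ-cancel-<
      (≤-<-trans (⌊⌋-≤ x) (STO.<-respʳ-≈ (sym fromℤ-1) x<1))))
    (≡.subst (0ℤ ℤ.≤_) (ℤ.pred-suc ⌊ x ⌋) (ℤ.i<j⇒i≤pred[j] (fromℤ-cancel-< {j = ℤ.suc ⌊ x ⌋}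
      (STO.trans 0<x (STO.<-respʳ-≈ fromℤ-suc (⌊⌋-< x))))))
    where
    fromℤ-suc : fromℤ ⌊ x ⌋ + 1# ≈ fromℤ (ℤ.suc ⌊ x ⌋)
    fromℤ-suc = begin
      fromℤ ⌊ x ⌋ + 1#            ≈⟨ +-comm _ _ ⟩
      1# + fromℤ ⌊ x ⌋            ≈⟨ +-congʳ fromℤ-1 ⟨
      fromℤ (+ 1) + fromℤ ⌊ x ⌋   ≈⟨ fromℤ-+ (+ 1) ⌊ x ⌋ ⟨
      fromℤ (ℤ.suc ⌊ x ⌋)         ∎

  _<?_ : ∀ x y → Dec (x < y)
  x <? y with STO.compare x y
  ... | tri< x<y _ _ = yes x<y
  ... | tri≈ x≮y _ _ = no x≮y
  ... | tri> x≮y _ _ = no x≮y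

  -- Powers and their growth.

  x≉0⇒x^n≉0 : ∀ {x} → ¬ x ≈ 0# → ∀ n → ¬ x ^ n ≈ 0#
  x≉0⇒x^n≉0 x≉0 zero    1≈0 = STO.irrefl (sym 1≈0) 0<1
  x≉0⇒x^n≉0 {x} x≉0 (suc n) x^1+n≈0 = x≉0⇒x^n≉0 x≉0 n (begin
    x ^ n                 ≈⟨ *-identityˡ _ ⟨
    1# * x ^ n            ≈⟨ *-congʳ (⁻¹-inverseʳ x≉0) ⟨
    x * x ⁻¹ * x ^ n
      ≈⟨ solve 3 (λ x y z → x :* y :* z := y :* (x :* z)) ≈-refl x (x ⁻¹) (x ^ n) ⟩
    x ⁻¹ * x ^ suc n      ≈⟨ *-congˡ x^1+n≈0 ⟩
    x ⁻¹ * 0#             ≈⟨ zeroʳ _ ⟩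
    0#                    ∎)

  -- Bernoulli's inequality. In the induction step the old difference is multiplied by 1 + δ and n
  -- δ² is added.
  bernoulli : ∀ {δ} → 0# ≤ δ → ∀ n → 0# ≤ (1# + δ) ^ n - (1# + n ×ₙ 1# * δ)
  bernoulli {δ} 0≤δ zero    = inj₂ (solve 1 (λ δ → con 0ℤ := con (+ 1) :- (con (+ 1) :+ con 0ℤ :* δ))
      ≈-refl δ)
  bernoulli {δ} 0≤δ (suc n) = 0≤-resp
    (solve 3 (λ δ p n → (con (+ 1) :+ δ) :* (p :- (con (+ 1) :+ n :* δ)) :+ n :* (δ :* δ) :=
       (con (+ 1) :+ δ) :* p :- (con (+ 1) :+ (con (+ 1) :+ n) :* δ))
           ≈-refl δ ((1# + δ) ^ n) (n ×ₙ 1#))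
    (0≤-+ (0≤-* (0≤-+ 0≤1 0≤δ) (bernoulli 0≤δ n)) (0≤-* (0≤n×1 n) (0≤-* 0≤δ 0≤δ)))

  -- Any m > n / δ works, because (1 + δ)ᵐ ≥ 1 + m δ > n.
  powers-unbounded : ∀ {δ} → 0# < δ → ∀ n → ∃ λ m → n ×ₙ 1# < (1# + δ) ^ m
  powers-unbounded {δ} 0<δ n =
    let m , n/δ<m = archimedean (n ×ₙ 1# / δ)
    in m , 0<y-x⇒x<y (0<-resp
      (solve 4 (λ p m δ n → p :- (con (+ 1) :+ m :* δ) :+ (con (+ 1) :+ (m :* δ :- n)) := p :- n)
        ≈-refl ((1# + δ) ^ m) (m ×ₙ 1#) δ (n ×ₙ 1#))
      (0≤x⇒0<y⇒0<x+y (bernoulli (inj₁ 0<δ) m) (0<x⇒0≤y⇒0<x+y 0<1 (inj₁ (0<-resp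
        (begin
          (m ×ₙ 1# - n ×ₙ 1# / δ) * δ
            ≈⟨ solve 4 (λ m n d δ → (m :- n :* d) :* δ := m :* δ :- n :* (δ :* d))
                ≈-refl (m ×ₙ 1#) (n ×ₙ 1#) (δ ⁻¹) δ ⟩
          m ×ₙ 1# * δ - n ×ₙ 1# * (δ * δ ⁻¹)
            ≈⟨ +-congˡ (-‿cong (*-congˡ (⁻¹-inverseʳ (λ eq → STO.irrefl (sym eq) 0<δ)))) ⟩
          m ×ₙ 1# * δ - n ×ₙ 1# * 1#            ≈⟨ +-congˡ (-‿cong (*-identityʳ _)) ⟩
          m ×ₙ 1# * δ - n ×ₙ 1#                 ∎)
        (*-pos (x<y⇒0<y-x n/δ<m) 0<δ))))))

  -- Positive and negative parts, and finite sums.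

  infix 8 _⁺ _⁻

  _⁺ : Carrier → Carrier
  x ⁺ with STO.compare 0# x
  ... | tri< _ _ _ = x
  ... | tri≈ _ _ _ = 0#
  ... | tri> _ _ _ = 0#

  -- Written as a difference so that x = x⁺ - x⁻ is a plain ring identity, with `x` and `x ⁺` as
  -- independent variables.
  _⁻ : Carrier → Carrier
  x ⁻ = x ⁺ - x

  0≤x⁺ : ∀ x → 0# ≤ x ⁺
  0≤x⁺ x with STO.compare 0# x
  ... | tri< 0<x _ _ = inj₁ 0<x
  ... | tri≈ _ _ _   = 0≤0
  ... | tri> _ _ _   = 0≤0

  x⁻≈0∨x⁻≈-x : ∀ x → x ⁻ ≈ 0# ⊎ x ⁻ ≈ - x
  x⁻≈0∨x⁻≈-x x with STO.compare 0# x
  ... | tri< _ _ _ = inj₁ (-‿inverseʳ x)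
  ... | tri≈ _ _ _ = inj₂ (+-identityˡ (- x))
  ... | tri> _ _ _ = inj₂ (+-identityˡ (- x))

  0≤x⁻ : ∀ x → 0# ≤ x ⁻
  0≤x⁻ x with STO.compare 0# x
  ... | tri< _ _ _   = inj₂ (sym (-‿inverseʳ x))
  ... | tri≈ _ 0≈x _ = inj₂ (sym (trans (+-congʳ 0≈x) (-‿inverseʳ x)))
  ... | tri> _ _ x<0 = inj₁ (x<y⇒0<y-x x<0)

  0≤sum : ∀ {n} (t : Vector Carrier n) → (∀ i → 0# ≤ t i) → 0# ≤ sum t
  0≤sum {zero}  t 0≤t = 0≤0
  0≤sum {suc n} t 0≤t = 0≤-+ (0≤t Fin.zero) (0≤sum (tail t) (λ i → 0≤t (Fin.suc i)))

  fromℤ-sum : ∀ {n} (a : Vector ℤ n) → fromℤ (sumℤ a) ≈ sum (λ i → fromℤ (a i))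
  fromℤ-sum {zero}  a = ≈-refl
  fromℤ-sum {suc n} a = trans (fromℤ-+ (head a) (sumℤ (tail a))) (+-congˡ (fromℤ-sum (tail a)))

  -- Integer intervals read in the reals.

  Between⇒≤ : ∀ {m k i} → Between m k i → 0# ≤ k ×ₙ 1# - fromℤ i
  Between⇒≤ {m} {k} (_ , i≤k) = x≤y⇒0≤y-x (fromℤ-mono-≤ {j = + k} i≤k)

  Between⇒≥ : ∀ {m k i} → Between m k i → 0# ≤ fromℤ i + m ×ₙ 1#
  Between⇒≥ {m} {k} {i} (-m≤i , _) = 0≤-resp
    (+-congˡ (trans (-‿cong (fromℤ-neg (+ m))) (-‿involutive _)))
    (x≤y⇒0≤y-x (fromℤ-mono-≤ -m≤i))

  -- Integrality turns the strict bounds -(m+1) < i < k+1 into weak ones. This gain of one unit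
  -- drives the descent.
  Between-intro : ∀ m k {i} → 0# < fromℤ i + suc m ×ₙ 1# → 0# < suc k ×ₙ 1# - fromℤ i →
                  Between m k i
  Between-intro m k {i} 0<i+m 0<k-i =
    ≡.subst (ℤ._≤ i) (ℤ.suc-pred (ℤ.- + m)) (ℤ.i<j⇒suc[i]≤j (fromℤ-cancel-< {ℤ.pred (ℤ.- + m)} below)) ,
    ℤ.i<j⇒i≤pred[j] {i} {+ suc k} (fromℤ-cancel-< {i} {+ suc k} (0<y-x⇒x<y 0<k-i))
    where
    below : fromℤ (ℤ.pred (ℤ.- + m)) < fromℤ i
    below = ≡.subst (λ j → fromℤ j < fromℤ i) (ℤ.neg-suc m)
      (0<y-x⇒x<y (0<-resp (+-congˡ (sym (-‿involutive _))) 0<i+m))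

  -- The weights, and integer combinations of them.

  module _ (β : Carrier) where

    -- Horner's scheme at -β, started at u: weights lists the successive values
    -- after u, and remainder is the last of them.
    weights : ∀ {n} → Carrier → Vector ℤ n → Vector Carrier n
    weights {suc n} u a Fin.zero    = fromℤ (head a) - β * u
    weights {suc n} u a (Fin.suc i) = weights (fromℤ (head a) - β * u) (tail a) i

    remainder : ∀ {n} → Carrier → Vector ℤ n → Carrier
    remainder {zero}  u a = u
    remainder {suc n} u a = remainder (fromℤ (head a) - β * u) (tail a)

    positives negatives : ∀ {n} → Carrier → Vector ℤ n → Carrier
    positives u a = sum (λ i → weights u a i ⁺)
    negatives u a = sum (λ i → weights u a i ⁻)

    -- Horner's scheme evaluates u xⁿ + ∑ aᵢ xⁿ⁻ⁱ at x = -β. Extracting (-1)ⁿ turns powers of -β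
    -- into powers of β with alternating signs.
    remainder≈alternatingPolynomial : ∀ {n} u (a : Vector ℤ n) →
      remainder u a ≈ (- 1#) ^ n *
        (u * β ^ n + sum (λ i → (- 1#) ^ suc (toℕ i) * fromℤ (a i) * β ^ (n ℕ.∸ suc (toℕ i))))
    remainder≈alternatingPolynomial {zero}  u a =
      solve 1 (λ u → u := con (+ 1) :* (u :* con (+ 1) :+ con 0ℤ)) ≈-refl u
    remainder≈alternatingPolynomial {suc n} u a = begin
      remainder u′ (tail a)               ≈⟨ remainder≈alternatingPolynomial u′ (tail a) ⟩
      s * (u′ * b + sum t)                ≈⟨ solve 6 (λ s u a₀ β b S →
          s :* ((a₀ :- β :* u) :* b :+ S) :=
          (:- con (+ 1)) :* s :* (u :* (β :* b) :+
            ((:- con (+ 1)) :* con (+ 1) :* a₀ :* b :+ (:- con (+ 1)) :* S)))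
        ≈-refl s u (fromℤ (head a)) β b (sum t) ⟩
      - 1# * s * (u * (β * b) + (- 1# * 1# * fromℤ (head a) * b + - 1# * sum t))
        ≈⟨ *-congˡ (+-congˡ (+-congˡ (trans (*-distribˡ-sum (- 1#) t)
             (sum-cong-≋ (λ i → negate (t i) ((- 1#) ^ suc (toℕ i)) _ _ ≈-refl))))) ⟩
      - 1# * s * (u * (β * b) + (- 1# * 1# * fromℤ (head a) * b +
        sum (λ i → (- 1#) ^ suc (suc (toℕ i)) * fromℤ (tail a i) * β ^ (n ℕ.∸ suc (toℕ i))))) ∎
      where
      u′ = fromℤ (head a) - β * u
      s = (- 1#) ^ n
      b = β ^ n
      t : Vector Carrier n
      t i = (- 1#) ^ suc (toℕ i) * fromℤ (tail a i) * β ^ (n ℕ.∸ suc (toℕ i))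

      negate : ∀ t x y z → t ≈ x * y * z → - 1# * t ≈ - 1# * x * y * z
      negate t x y z eq = trans (*-congˡ eq)
        (solve 3 (λ x y z → (:- con (+ 1)) :* (x :* y :* z) := (:- con (+ 1)) :* x :* y :* z)
            ≈-refl x y z)

    alternatingPolynomial-root : ∀ {n} (a : Vector ℤ n) →
      alternatingPolynomial a β ≈ 0# → remainder 1# a ≈ 0#
    alternatingPolynomial-root {n} a root = begin
      remainder 1# a                                 ≈⟨ remainder≈alternatingPolynomial 1# a ⟩
      (- 1#) ^ n * (1# * β ^ n + _)                  ≈⟨ *-congˡ (+-congʳ (*-identityˡ _)) ⟩
      (- 1#) ^ n * alternatingPolynomial a β         ≈⟨ *-congˡ root ⟩
      (- 1#) ^ n * 0#                                ≈⟨ zeroʳ _ ⟩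
      0#                                             ∎

    -- Sums the recurrence aⱼ = wⱼ₊₁ + β wⱼ. The weights after `u` add up to W; the ones multiplied
    -- by β add up to u + W, because the last weight, which is absent there, is zero.
    sum-coefficients : ∀ {n} u (a : Vector ℤ n) → remainder u a ≈ 0# →
      let W = positives u a - negatives u a in
      sum (λ i → fromℤ (a i)) ≈ W + β * (u + W)
    sum-coefficients {zero} u a u≈0 = begin
      0#
        ≈⟨ solve 1 (λ β → con 0ℤ := con 0ℤ :- con 0ℤ :+ β :* (con 0ℤ :+ (con 0ℤ :- con 0ℤ)))
            ≈-refl β ⟩
      0# - 0# + β * (0# + (0# - 0#))       ≈⟨ +-congˡ (*-congˡ (+-congʳ u≈0)) ⟨
      0# - 0# + β * (u + (0# - 0#))        ∎
    sum-coefficients {suc n} u a r≈0 = begin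
      a₀ + sum (λ i → fromℤ (tail a i))     ≈⟨ +-congˡ (sum-coefficients u′ (tail a) r≈0) ⟩
      a₀ + (P - N + β * (u′ + (P - N)))      ≈⟨ solve 6 (λ a₀ β u p P N →
          let W = p :+ P :- (p :- (a₀ :- β :* u) :+ N) in
          a₀ :+ (P :- N :+ β :* ((a₀ :- β :* u) :+ (P :- N))) := W :+ β :* (u :+ W))
        ≈-refl a₀ β u (u′ ⁺) P N ⟩
      (u′ ⁺ + P - (u′ ⁻ + N)) + β * (u + (u′ ⁺ + P - (u′ ⁻ + N)))  ∎
      where
      a₀ = fromℤ (head a)
      u′ = a₀ - β * u
      P = positives u′ (tail a)
      N = negatives u′ (tail a)

    combination : ∀ {n} → Carrier → Vector ℤ n → (ℕ → ℤ) → Carrier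
    combination u a h = sum (λ i → fromℤ (h (toℕ i)) * weights u a i)

    combination-0 : ∀ {n} u (a : Vector ℤ n) h → (∀ j → j ℕ.< n → h j ≡ 0ℤ) →
                    combination u a h ≈ 0#
    combination-0 {zero}  u a h h≡0 = ≈-refl
    combination-0 {suc n} u a h h≡0 = begin
      fromℤ (h 0) * u′ + combination u′ (tail a) (h ∘ suc)
        ≈⟨ +-cong (*-congʳ (reflexive (≡.cong fromℤ (h≡0 0 ℕ.z<s))))
             (combination-0 u′ (tail a) (h ∘ suc) (λ j j<n → h≡0 (suc j) (ℕ.s<s j<n))) ⟩
      0# * u′ + 0#   ≈⟨ trans (+-identityʳ _) (zeroˡ u′) ⟩
      0#             ∎
      where u′ = fromℤ (head a) - β * u

    combination-minus : ∀ {n} u (a : Vector ℤ n) g h →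
      combination u a (λ j → g j ℤ.- h j) ≈ combination u a g - combination u a h
    combination-minus {zero}  u a g h = sym (-‿inverseʳ 0#)
    combination-minus {suc n} u a g h = begin
      fromℤ (g 0 ℤ.- h 0) * u′ + combination u′ (tail a) (λ j → g (suc j) ℤ.- h (suc j))
        ≈⟨ +-cong (*-congʳ (fromℤ-minus (g 0) (h 0)))
            (combination-minus u′ (tail a) (g ∘ suc) (h ∘ suc)) ⟩
      (fromℤ (g 0) - fromℤ (h 0)) * u′ + (G - H)
        ≈⟨ solve 5 (λ g h u G H → (g :- h) :* u :+ (G :- H) := g :* u :+ G :- (h :* u :+ H))
             ≈-refl (fromℤ (g 0)) (fromℤ (h 0)) u′ G H ⟩
      fromℤ (g 0) * u′ + G - (fromℤ (h 0) * u′ + H) ∎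
      where
      u′ = fromℤ (head a) - β * u
      G = combination u′ (tail a) (g ∘ suc)
      H = combination u′ (tail a) (h ∘ suc)

    dot : ∀ {n} → Vector ℤ n → (ℕ → ℤ) → ℤ
    dot a h = sumℤ (λ i → h (toℕ i) ℤ.* a i)

    -- Since -β wⱼ = wⱼ₊₁ - aⱼ, multiplication by -β moves every coefficient to the next weight at
    -- the cost of the integer `dot a h`. The last coefficient multiplies the zero remainder and
    -- disappears.
    combination-shift : ∀ {n} u (a : Vector ℤ n) h → remainder u a ≈ 0# →
      - β * (fromℤ (h 0) * u + combination u a (h ∘ suc)) + fromℤ (dot a h) ≈ combination u a h
    combination-shift {zero} u a h u≈0 = begin
      - β * (fromℤ (h 0) * u + 0#) + 0#    ≈⟨ +-congʳ (*-congˡ (+-congʳ (*-congˡ u≈0))) ⟩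
      - β * (fromℤ (h 0) * 0# + 0#) + 0#
        ≈⟨ solve 2 (λ β x → (:- β) :* (x :* con 0ℤ :+ con 0ℤ) :+ con 0ℤ := con 0ℤ)
            ≈-refl β (fromℤ (h 0)) ⟩
      0#                                   ∎
    combination-shift {suc n} u a h r≈0 = begin
      - β * (h₀ * u + (h₁ * u′ + C)) + fromℤ (h 0 ℤ.* head a ℤ.+ D)
        ≈⟨ +-congˡ (trans (fromℤ-+ (h 0 ℤ.* head a) D) (+-congʳ (fromℤ-* (h 0) (head a)))) ⟩
      - β * (h₀ * u + (h₁ * u′ + C)) + (h₀ * a₀ + fromℤ D)
        ≈⟨ solve 7 (λ β h₀ u s u′ a₀ D →
             (:- β) :* (h₀ :* u :+ s) :+ (h₀ :* a₀ :+ D) :=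
             h₀ :* (a₀ :- β :* u) :+ ((:- β) :* s :+ D))
             ≈-refl β h₀ u (h₁ * u′ + C) u′ a₀ (fromℤ D) ⟩
      h₀ * u′ + (- β * (h₁ * u′ + C) + fromℤ D)
        ≈⟨ +-congˡ (combination-shift u′ (tail a) (h ∘ suc) r≈0) ⟩
      h₀ * u′ + combination u′ (tail a) (h ∘ suc)  ∎
      where
      a₀ = fromℤ (head a)
      h₀ = fromℤ (h 0)
      h₁ = fromℤ (h 1)
      u′ = a₀ - β * u
      C = combination u′ (tail a) (h ∘ suc ∘ suc)
      D = dot (tail a) (h ∘ suc)

    module _ (m k : ℕ) where
      private
        M K : Carrier
        M = m ×ₙ 1#
        K = k ×ₙ 1#

      -- Termwise, K w⁺ + M w⁻ - h w = (K - h) w⁺ + (h + M) w⁻, and both products are nonnegative.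
      combination-≤ : ∀ {n} u (a : Vector ℤ n) h → (∀ j → j ℕ.< n → Between m k (h j)) →
        0# ≤ K * positives u a + M * negatives u a - combination u a h
      combination-≤ {zero}  u a h _ = inj₂ (solve 2 (λ K M → con 0ℤ := K :* con 0ℤ :+ M :* con 0ℤ :- con 0ℤ)
          ≈-refl K M)
      combination-≤ {suc n} u a h b = 0≤-resp
        (solve 8 (λ M K x p u P N C →
            let v = p :- u in
            ((K :- x) :* p :+ (x :+ M) :* v) :+ (K :* P :+ M :* N :- C) :=
            K :* (p :+ P) :+ M :* (v :+ N) :- (x :* u :+ C))
          ≈-refl M K (fromℤ (h 0)) (u′ ⁺) u′ (positives u′ (tail a)) (negatives u′ (tail a))
            (combination u′ (tail a) (h ∘ suc)))
        (0≤-+ (0≤-+ (0≤-* (Between⇒≤ (b 0 ℕ.z<s)) (0≤x⁺ u′)) (0≤-* (Between⇒≥ (b 0 ℕ.z<s)) (0≤x⁻ u′)))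
          (combination-≤ u′ (tail a) (h ∘ suc) (λ j j<n → b (suc j) (ℕ.s<s j<n))))
        where u′ = fromℤ (head a) - β * u

      combination-≥ : ∀ {n} u (a : Vector ℤ n) h → (∀ j → j ℕ.< n → Between m k (h j)) →
        0# ≤ M * positives u a + K * negatives u a + combination u a h
      combination-≥ {zero}  u a h _ = inj₂ (solve 2 (λ K M → con 0ℤ := M :* con 0ℤ :+ K :* con 0ℤ :+ con 0ℤ)
          ≈-refl K M)
      combination-≥ {suc n} u a h b = 0≤-resp
        (solve 8 (λ M K x p u P N C →
            let v = p :- u in
            ((x :+ M) :* p :+ (K :- x) :* v) :+ (M :* P :+ K :* N :+ C) :=
            M :* (p :+ P) :+ K :* (v :+ N) :+ (x :* u :+ C))
          ≈-refl M K (fromℤ (h 0)) (u′ ⁺) u′ (positives u′ (tail a)) (negatives u′ (tail a))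
            (combination u′ (tail a) (h ∘ suc)))
        (0≤-+ (0≤-+ (0≤-* (Between⇒≥ (b 0 ℕ.z<s)) (0≤x⁺ u′)) (0≤-* (Between⇒≤ (b 0 ℕ.z<s)) (0≤x⁻ u′)))
          (combination-≥ u′ (tail a) (h ∘ suc) (λ j j<n → b (suc j) (ℕ.s<s j<n))))
        where u′ = fromℤ (head a) - β * u

    -- The transformation, its fixed point 0 and vanishing digits.

    module _ (1<β : 1# < β) where

      0<β : 0# < β
      0<β = STO.trans 0<1 1<β

      0≤β : 0# ≤ β
      0≤β = inj₁ 0<β

      0<β+1 : 0# < β + 1#
      0<β+1 = 0<x⇒0≤y⇒0<x+y 0<β 0≤1

      0≤β+1 : 0# ≤ β + 1#
      0≤β+1 = inj₁ 0<β+1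

      open NegativeBase ℝ β using (ℓᵦ; T₋ᵦ; digit;
          scaled; InRange; IsMinimalExponent; expansionWith; PropertyMinusF)

      [β+1]ℓᵦ≈-β : (β + 1#) * ℓᵦ ≈ - β
      [β+1]ℓᵦ≈-β = begin
        (β + 1#) * (- β * (β + 1#) ⁻¹)
          ≈⟨ solve 3 (λ b β c → b :* ((:- β) :* c) := (:- β) :* (b :* c)) ≈-refl (β + 1#) β _ ⟩
        - β * ((β + 1#) * (β + 1#) ⁻¹)
          ≈⟨ *-congˡ (⁻¹-inverseʳ (λ eq → STO.irrefl (sym eq) 0<β+1)) ⟩
        - β * 1#                          ≈⟨ *-identityʳ _ ⟩
        - β                               ∎

      -- Multiplying by β + 1 clears the denominator of ℓᵦ: the ends of [ℓᵦ, ℓᵦ + 1) become -β and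
      -- 1. Only the inequalities of the floor enter, so `y` may be any real.
      T₋ᵦ-lower : ∀ y → 0# ≤ (β + 1#) * T₋ᵦ y + β
      T₋ᵦ-lower y = 0≤-resp
        (trans (solve 5 (λ b ℓ v f β → b :* (v :- ℓ :- f) := b :* (v :- f) :- b :* ℓ)
            ≈-refl (β + 1#) ℓᵦ (- β * y) _ β)
               (+-congˡ (trans (-‿cong [β+1]ℓᵦ≈-β) (-‿involutive β))))
        (0≤-* 0≤β+1 (x≤y⇒0≤y-x (⌊⌋-≤ (- β * y - ℓᵦ))))

      T₋ᵦ-upper : ∀ y → 0# < 1# - (β + 1#) * T₋ᵦ y
      T₋ᵦ-upper y = 0<-resp
        (begin
          (β + 1#) * (f + 1# - (v - ℓᵦ))
            ≈⟨ solve 4 (λ b ℓ v f → b :* (f :+ con (+ 1) :- (v :- ℓ)) := b :+ b :* ℓ :- b :* (v :- f))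
                ≈-refl (β + 1#) ℓᵦ v f ⟩
          β + 1# + (β + 1#) * ℓᵦ - (β + 1#) * (v - f)
            ≈⟨ +-congʳ (+-congˡ [β+1]ℓᵦ≈-β) ⟩
          β + 1# + - β - (β + 1#) * (v - f)
            ≈⟨ +-congʳ (solve 1 (λ β → β :+ con (+ 1) :+ (:- β) := con (+ 1)) ≈-refl β) ⟩
          1# - (β + 1#) * (v - f) ∎)
        (*-pos 0<β+1 (x<y⇒0<y-x (⌊⌋-< (v - ℓᵦ))))
        where
        v = - β * y
        f = fromℤ ⌊ v - ℓᵦ ⌋

      -- Together with `0<1+ℓᵦ` this places -ℓᵦ strictly between 0 and 1, so the digit produced at 0
      -- is 0.
      0<-ℓᵦ : 0# < - ℓᵦ
      0<-ℓᵦ = 0<x⇒0<xy⇒0<y 0<β+1 (0<-resp (begin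
        β                      ≈⟨ -‿involutive β ⟨
        - (- β)                ≈⟨ -‿cong [β+1]ℓᵦ≈-β ⟨
        - ((β + 1#) * ℓᵦ)      ≈⟨ -‿distribʳ-* _ _ ⟩
        (β + 1#) * (- ℓᵦ)      ∎) 0<β)

      0<1+ℓᵦ : 0# < 1# - - ℓᵦ
      0<1+ℓᵦ = 0<x⇒0<xy⇒0<y 0<β+1 (0<-resp (begin
        1#
          ≈⟨ solve 1 (λ β → con (+ 1) := β :+ con (+ 1) :+ (:- β)) ≈-refl β ⟩
        β + 1# + - β               ≈⟨ +-congˡ [β+1]ℓᵦ≈-β ⟨
        β + 1# + (β + 1#) * ℓᵦ
          ≈⟨ solve 2 (λ b ℓ → b :+ b :* ℓ := b :* (con (+ 1) :- (:- ℓ))) ≈-refl (β + 1#) ℓᵦ ⟩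
        (β + 1#) * (1# - - ℓᵦ)     ∎) 0<1)

      ⌊-βz-ℓᵦ⌋≡0 : ∀ {z} → z ≈ 0# → ⌊ - β * z - ℓᵦ ⌋ ≡ 0ℤ
      ⌊-βz-ℓᵦ⌋≡0 {z} z≈0 = ⌊⌋≡0 (0<-resp eq 0<-ℓᵦ) (STO.<-respˡ-≈ eq (0<y-x⇒x<y 0<1+ℓᵦ))
        where
        eq : - ℓᵦ ≈ - β * z - ℓᵦ
        eq = sym (trans (+-congʳ (trans (*-congˡ z≈0) (zeroʳ _))) (+-identityˡ _))

      T₋ᵦ-0 : ∀ {z} → z ≈ 0# → T₋ᵦ z ≈ 0#
      T₋ᵦ-0 {z} z≈0 = begin
        - β * z - fromℤ ⌊ - β * z - ℓᵦ ⌋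
          ≈⟨ +-cong (*-congˡ z≈0) (-‿cong (reflexive (≡.cong fromℤ (⌊-βz-ℓᵦ⌋≡0 z≈0)))) ⟩
        - β * 0# - 0#
          ≈⟨ solve 1 (λ β → (:- β) :* con 0ℤ :- con 0ℤ := con 0ℤ) ≈-refl β ⟩
        0#                                 ∎

      digits-vanish : ∀ {z m} → fold z T₋ᵦ m ≈ 0# → ∀ j → m ℕ.≤ j → digit z j ≡ 0ℤ
      digits-vanish Tz≈0 j m≤j = ⌊-βz-ℓᵦ⌋≡0 (fold-preserves T₋ᵦ (_≈ 0#) T₋ᵦ-0 Tz≈0 j m≤j)

      -- Existence of the minimal exponent.

      [-β]^n≉0 : ∀ n → ¬ (- β) ^ n ≈ 0#
      [-β]^n≉0 = x≉0⇒x^n≉0 (λ -β≈0 → STO.irrefl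
        (trans (sym -0#≈0#) (trans (-‿cong (sym -β≈0)) (-‿involutive β))) 0<β)

      -- Even exponents avoid the sign: (-β)² = 1 + (β - 1)(β + 1), whose excess over 1 is positive.
      even-powers-unbounded : ∀ n → ∃ λ k → n ×ₙ 1# < (- β) ^ k
      even-powers-unbounded n =
        let m , n<β²ᵐ = powers-unbounded {(β - 1#) * (β + 1#)} (*-pos (x<y⇒0<y-x 1<β) 0<β+1) n
        in 2 ℕ.* m , STO.<-respʳ-≈ (begin
          (1# + (β - 1#) * (β + 1#)) ^ m
            ≈⟨ ^-congˡ m (solve 1 (λ β → con (+ 1) :+ (β :- con (+ 1)) :* (β :+ con (+ 1)) :=
                                                (:- β) :* ((:- β) :* con (+ 1))) ≈-refl β) ⟩
          ((- β) ^ 2) ^ m                  ≈⟨ ^-assocʳ (- β) 2 m ⟩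
          (- β) ^ (2 ℕ.* m)                ∎) n<β²ᵐ

      -- If B exceeds p + q where p and q bound ± (β + 1) x, then the scaled
      -- number s = x / B satisfies -β B < (β + 1) B s < B.
      inRange : ∀ x {k p q} → (β + 1#) * x < p ×ₙ 1# → - ((β + 1#) * x) < q ×ₙ 1# →
                (p ℕ.+ q) ×ₙ 1# < (- β) ^ k → InRange x k
      inRange x {k} {p} {q} bx<p -bx<q p+q<B =
        0<y-x⇒x<y (0<x⇒0<xy⇒0<y 0<Bb lower) , 0<y-x⇒x<y (0<x⇒0<xy⇒0<y 0<Bb upper)
        where
        b B s P Q : Carrier
        b = β + 1#
        B = (- β) ^ k
        s = scaled x k
        P = p ×ₙ 1#
        Q = q ×ₙ 1#
        0<B : 0# < B
        0<B = ≤-<-trans (0≤n×1 (p ℕ.+ q)) p+q<B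
        Bs≈x : B * s ≈ x
        Bs≈x = begin
          B * (x * B ⁻¹)   ≈⟨ solve 3 (λ B x c → B :* (x :* c) := x :* (B :* c)) ≈-refl B x (B ⁻¹) ⟩
          x * (B * B ⁻¹)   ≈⟨ *-congˡ (⁻¹-inverseʳ ([-β]^n≉0 k)) ⟩
          x * 1#           ≈⟨ *-identityʳ x ⟩
          x                ∎
        0<B-[P+Q] : 0# < B - (P + Q)
        0<B-[P+Q] = 0<-resp (+-congˡ (-‿cong (×-homo-+ 1# p q))) (x<y⇒0<y-x p+q<B)
        0<Bb : 0# < B * b
        0<Bb = *-pos 0<B 0<β+1
        lower : 0# < B * b * (s - ℓᵦ)
        lower = 0<-resp (begin
            B - (P + Q) + ((Q - - (b * x)) + (P + B * (β - 1#)))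
              ≈⟨ solve 5 (λ B P Q y β → B :- (P :+ Q) :+ ((Q :- (:- y)) :+ (P :+ B :* (β :- con (+ 1)))) :=
                   y :- B :* (:- β)) ≈-refl B P Q (b * x) β ⟩
            b * x - B * (- β)
              ≈⟨ +-cong (*-congˡ (sym Bs≈x)) (-‿cong (*-congˡ (sym [β+1]ℓᵦ≈-β))) ⟩
            b * (B * s) - B * (b * ℓᵦ)
              ≈⟨ solve 4 (λ B b s ℓ → b :* (B :* s) :- B :* (b :* ℓ) := B :* b :* (s :- ℓ))
                  ≈-refl B b s ℓᵦ ⟩
            B * b * (s - ℓᵦ) ∎)
            (0<x⇒0≤y⇒0<x+y 0<B-[P+Q] (0≤-+ (inj₁ (x<y⇒0<y-x -bx<q))
              (0≤-+ (0≤n×1 p) (0≤-* (inj₁ 0<B) (inj₁ (x<y⇒0<y-x 1<β))))))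
        upper : 0# < B * b * (ℓᵦ + 1# - s)
        upper = 0<-resp (begin
            B - (P + Q) + (Q + (P - b * x))
              ≈⟨ solve 5 (λ B P Q y β → B :- (P :+ Q) :+ (Q :+ (P :- y)) :=
                   B :* (:- β) :+ B :* (β :+ con (+ 1)) :- y) ≈-refl B P Q (b * x) β ⟩
            B * (- β) + B * b - b * x
              ≈⟨ +-cong (+-congʳ (*-congˡ (sym [β+1]ℓᵦ≈-β))) (-‿cong (*-congˡ (sym Bs≈x))) ⟩
            B * (b * ℓᵦ) + B * b - b * (B * s)
              ≈⟨ solve 4 (λ B b s ℓ → B :* (b :* ℓ) :+ B :* b :- b :* (B :* s) := B :* b :* (ℓ :+ con (+ 1) :- s))
                  ≈-refl B b s ℓᵦ ⟩
            B * b * (ℓᵦ + 1# - s) ∎)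
            (0<x⇒0≤y⇒0<x+y 0<B-[P+Q] (0≤-+ (0≤n×1 q) (inj₁ (x<y⇒0<y-x bx<p))))

      exponent : ∀ x → ∃ (InRange x)
      exponent x =
        let p , bx<p = archimedean ((β + 1#) * x)
            q , -bx<q = archimedean (- ((β + 1#) * x))
            k , p+q<B = even-powers-unbounded (p ℕ.+ q)
        in k , inRange x {k} {p} {q} bx<p -bx<q p+q<B

      minimalExponent : ∀ x → ∃ (IsMinimalExponent x)
      minimalExponent x =
        let k , x∈ = exponent x
        in least (λ k → (ℓᵦ <? scaled x k) ×-dec (scaled x k <? (ℓᵦ + 1#))) k x∈

      finitelyManyNonzero : ∀ x k {m} → fold (scaled x k) T₋ᵦ m ≈ 0# →
                            OnlyFinitelyManyNonzero (expansionWith x k)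
      finitelyManyNonzero x zero    {m} Tz≈0 = m , digits-vanish {scaled x 0} {m} Tz≈0
      finitelyManyNonzero x (suc k) {m} Tz≈0 =
        -- Fractional digit j sits at position suc k + j of the digit sequence, which is at least m
        -- as soon as j is.
        m , λ j m≤j → digits-vanish {scaled x (suc k)} {m} Tz≈0 (suc k ℕ.+ j)
                        (ℕ.≤-trans m≤j (ℕ.m≤n+m j (suc k)))

      -- Bounds on the weights from the coefficient condition.

      -- A negative weight u forces the next one, a₀ - β u, to be at least -β u.
      negatives≤positives : ∀ {n} u (a : Vector ℤ n) → remainder u a ≈ 0# →
        (∀ i → 0ℤ ℤ.≤ a i) → 0# ≤ positives u a - β * (u ⁻ + negatives u a)
      negatives≤positives {zero} u a u≈0 _ = inj₂ (begin
        0#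
          ≈⟨ solve 1 (λ β → con 0ℤ := con 0ℤ :- β :* (con 0ℤ :+ con 0ℤ)) ≈-refl β ⟩
        0# - β * (0# + 0#)        ≈⟨ +-congˡ (-‿cong (*-congˡ (+-congʳ u⁻≈0))) ⟨
        0# - β * (u ⁻ + 0#)       ∎)
        where
        u⁻≈0 : u ⁻ ≈ 0#
        u⁻≈0 with x⁻≈0∨x⁻≈-x u
        ... | inj₁ eq = eq
        ... | inj₂ eq = trans eq (trans (-‿cong u≈0) -0#≈0#)
      negatives≤positives {suc n} u a r≈0 0≤a = 0≤-resp
        (solve 6 (λ β p P v v′ N →
          (p :- β :* v) :+ (P :- β :* (v′ :+ N)) := (p :+ P) :- β :* (v :+ (v′ :+ N)))
          ≈-refl β (u′ ⁺) P (u ⁻) (u′ ⁻) N)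
        (0≤-+ next (negatives≤positives u′ (tail a) r≈0 (λ i → 0≤a (Fin.suc i))))
        where
        a₀ = fromℤ (head a)
        u′ = a₀ - β * u
        P = positives u′ (tail a)
        N = negatives u′ (tail a)
        next : 0# ≤ u′ ⁺ - β * u ⁻
        next with x⁻≈0∨x⁻≈-x u
        ... | inj₁ u⁻≈0  = 0≤-resp
          (trans (solve 2 (λ p β → p := p :- β :* con 0ℤ) ≈-refl (u′ ⁺) β)
                 (+-congˡ (-‿cong (*-congˡ (sym u⁻≈0)))))
          (0≤x⁺ u′)
        -- Here u′⁺ - β u⁻ = a₀ + u′⁻, and a₀ ≥ 0.
        ... | inj₂ u⁻≈-u = 0≤-resp
          (trans (solve 4 (λ p a₀ β u → a₀ :+ (p :- (a₀ :- β :* u)) := p :- β :* (:- u))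
              ≈-refl (u′ ⁺) a₀ β u)
                 (+-congˡ (-‿cong (*-congˡ (sym u⁻≈-u)))))
          (0≤-+ (0≤fromℤ (0≤a Fin.zero)) (0≤x⁻ u′))

      module _ {n : ℕ} (a : Vector ℤ (suc n)) (root : remainder 1# a ≈ 0#)
               (0≤a : ∀ i → 0ℤ ℤ.≤ a i)
               (dominant : + 2 ℤ.+ sumℤ (tail a) ℤ.≤ head a) where

        private
          P N a₁ u P′ N′ R : Carrier
          P  = positives 1# a
          N  = negatives 1# a
          a₁ = fromℤ (head a)
          u  = a₁ - β * 1#
          P′ = positives u (tail a)
          N′ = negatives u (tail a)
          R  = 1# - (β + 1#) * N - u ⁺

          -- The dominance hypothesis, with a₂ + ⋯ + a_d expressed through the weights by
          -- `sum-coefficients` started at u = w₂.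
          slack : 0# ≤ a₁ - (1# + 1#) - (P′ - N′ + β * (u + (P′ - N′)))
          slack = 0≤-resp
            (trans (+-congˡ (-‿cong (trans (fromℤ-+ (+ 2) (sumℤ (tail a)))
               (+-cong (+-congˡ fromℤ-1) (trans (fromℤ-sum (tail a))
                   (sum-coefficients u (tail a) root))))))
              (solve 2 (λ x y → x :- (con (+ 1) :+ con (+ 1) :+ y) := x :- (con (+ 1) :+ con (+ 1)) :- y)
                  ≈-refl a₁ _))
            (x≤y⇒0≤y-x (fromℤ-mono-≤ dominant))

          -- As N = u⁻ + N′, the product (β - 1) R equals 1 + (β + 1)(P′ - β N) + slack + 2 u⁻, and
          -- `negatives≤positives` bounds the second term.
          0<R : 0# < R
          0<R = 0<x⇒0<xy⇒0<y (x<y⇒0<y-x 1<β) (0<-resp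
            (solve 5 (λ β a₁ p P N →
              let u = a₁ :- β :* con (+ 1)
                  v = p :- u
                  one = con (+ 1)
              in
              one :+ ((β :+ one) :* (P :- β :* (v :+ N)) :+
                 (a₁ :- (one :+ one) :- (P :- N :+ β :* (u :+ (P :- N)))) :+ (v :+ v))
              := (β :- one) :* (one :- (β :+ one) :* (v :+ N) :- p))
              ≈-refl β a₁ (u ⁺) P′ N′)
            (0<x⇒0≤y⇒0<x+y 0<1 (0≤-+ (0≤-+ (0≤-* 0≤β+1
              (negatives≤positives u (tail a) root (λ i → 0≤a (Fin.suc i)))) slack)
              (0≤-+ (0≤x⁻ u) (0≤x⁻ u)))))

        [β+1]negatives<1 : 0# < 1# - (β + 1#) * N
        [β+1]negatives<1 = 0<-resp
          (solve 2 (λ x p → (x :- p) :+ p := x) ≈-refl (1# - (β + 1#) * N) (u ⁺))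
          (0<x⇒0≤y⇒0<x+y 0<R (0≤x⁺ u))

        -- The difference equals 2 R + slack + 2 u⁻.
        [β+1]absolutes<β : 0# < β - (β + 1#) * (P + N)
        [β+1]absolutes<β = 0<-resp
          (solve 5 (λ β a₁ p P N →
            let u = a₁ :- β :* con (+ 1)
                v = p :- u
                one = con (+ 1)
                R = one :- (β :+ one) :* (v :+ N) :- p
            in
            R :+ (R :+ ((a₁ :- (one :+ one) :- (P :- N :+ β :* (u :+ (P :- N)))) :+ (v :+ v)))
            := β :- (β :+ one) :* (p :+ P :+ (v :+ N)))
            ≈-refl β a₁ (u ⁺) P′ N′)
          (0<x⇒0≤y⇒0<x+y 0<R (0≤-+ (inj₁ 0<R)
            (0≤-+ slack (0≤-+ (0≤x⁻ u) (0≤x⁻ u)))))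

        -- The lattice of integer combinations and the action of the transformation.

        record InLattice (z : Carrier) (h : ℕ → ℤ) : Set ℓ₁ where
          constructor inLattice
          -- `h 0` belongs to w₁ = 1, which precedes the list of weights; the last weight in the
          -- list is the zero remainder.
          field decomposition : z ≈ fromℤ (h 0) + combination 1# a (h ∘ suc)

        open InLattice

        multiply-lattice : ∀ {z h} → InLattice z h →
          - β * z ≈ fromℤ (ℤ.- dot a h) + combination 1# a h
        multiply-lattice {z} {h} (inLattice z∈) = begin
          - β * z
            ≈⟨ *-congˡ (trans z∈ (+-congʳ (sym (*-identityʳ _)))) ⟩
          - β * s
            ≈⟨ solve 2 (λ x d → x := (:- d) :+ (x :+ d)) ≈-refl (- β * s) D ⟩
          - D + (- β * s + D)
            ≈⟨ +-cong (sym (fromℤ-neg (dot a h))) (combination-shift 1# a h root) ⟩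
          fromℤ (ℤ.- dot a h) + combination 1# a h  ∎
          where
          s = fromℤ (h 0) * 1# + combination 1# a (h ∘ suc)
          D = fromℤ (dot a h)

        -- Multiplication by -β shifts `h`, and subtracting the floor changes only the new
        -- coefficient of w₁.
        T₋ᵦ-lattice : ∀ {z h} → InLattice z h → ∃ λ i → InLattice (T₋ᵦ z) (i ∷ₛ h)
        T₋ᵦ-lattice {z} {h} z∈ = ℤ.- dot a h ℤ.- f , inLattice (begin
          - β * z - fromℤ f                              ≈⟨ +-congʳ (multiply-lattice z∈) ⟩
          fromℤ (ℤ.- dot a h) + C - fromℤ f
            ≈⟨ solve 3 (λ d c f → d :+ c :- f := d :- f :+ c)
                ≈-refl (fromℤ (ℤ.- dot a h)) C (fromℤ f) ⟩
          fromℤ (ℤ.- dot a h) - fromℤ f + C              ≈⟨ +-congʳ (fromℤ-minus (ℤ.- dot a h) f) ⟨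
          fromℤ (ℤ.- dot a h ℤ.- f) + C                  ∎)
          where
          f = ⌊ - β * z - ℓᵦ ⌋
          C = combination 1# a h

        private
          d : ℕ
          d = suc n

        -- Bounds on the newest coefficient.

        module _ (m : ℕ) (y : Carrier) (i : ℤ) (h : ℕ → ℤ) (Ty∈ : InLattice (T₋ᵦ y) (i ∷ₛ h)) where
          private
            x C M : Carrier
            x = fromℤ i
            C = combination 1# a h
            M = m ×ₙ 1#

            lower : 0# ≤ (β + 1#) * (x + C) + β
            lower = 0≤-resp (+-congʳ (*-congˡ (decomposition Ty∈))) (T₋ᵦ-lower y)

            upper : 0# < 1# - (β + 1#) * (x + C)
            upper = 0<-resp (+-congˡ (-‿cong (*-congˡ (decomposition Ty∈)))) (T₋ᵦ-upper y)

            -- From (β + 1)(x + C) < 1 and -(β + 1) C ≤ (m + 1) β one gets (β + 1) x < 1 + (m + 1) β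
            -- ≤ (m + 1)(β + 1).
            below : (∀ j → j ℕ.< d → Between (suc m) (suc m) (h j)) → 0# < suc m ×ₙ 1# - x
            below b = 0<x⇒0<xy⇒0<y 0<β+1 (0<-resp
              (solve 6 (λ β x C M P N →
                let one = con (+ 1) in
                (one :- (β :+ one) :* (x :+ C)) :+
                ((β :+ one) :* ((one :+ M) :* P :+ (one :+ M) :* N :+ C) :+
                 (M :+ (one :+ M) :* (β :- (β :+ one) :* (P :+ N)))) :=
                (β :+ one) :* (one :+ M :- x))
                ≈-refl β x C M P N)
              (0<x⇒0≤y⇒0<x+y upper (0≤-+ (0≤-* 0≤β+1 (combination-≥ (suc m) (suc m) 1# a h b))
                (0≤-+ (0≤n×1 m) (0≤-* (0≤n×1 (suc m)) (inj₁ [β+1]absolutes<β))))))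

          Between-wide : (∀ j → j ℕ.< d → Between (suc m) (suc m) (h j)) → Between (suc m) m i
          Between-wide b = Between-intro (suc m) m (0<x⇒0<xy⇒0<y 0<β+1 (0<-resp
            (solve 6 (λ β x C M P N →
                let one = con (+ 1) ; K = one :+ M in
                one :+ (((β :+ one) :* (x :+ C) :+ β) :+
                ((β :+ one) :* (K :* P :+ K :* N :- C) :+
                 (K :+ K :* (β :- (β :+ one) :* (P :+ N))))) :=
                (β :+ one) :* (x :+ (one :+ K)))
                ≈-refl β x C M P N)
            (0<x⇒0≤y⇒0<x+y 0<1 (0≤-+ lower
              (0≤-+ (0≤-* 0≤β+1 (combination-≤ (suc m) (suc m) 1# a h b))
                (0≤-+ (0≤n×1 (suc m)) (0≤-* (0≤n×1 (suc m)) (inj₁ [β+1]absolutes<β)))))))) (below b)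

          -- Now C ≤ m P + (m + 1) N = m (P + N) + N: the extra unit meets only negative weights. So
          -- (β + 1) C < m β + 1, and (β + 1) x > -(m + 1) β - 1 ≥ -(m + 1)(β + 1).
          Between-narrow : (∀ j → j ℕ.< d → Between (suc m) m (h j)) → Between m m i
          Between-narrow b = Between-intro m m (0<x⇒0<xy⇒0<y 0<β+1 (0<-resp
            (solve 6 (λ β x C M P N →
                let one = con (+ 1) ; K = one :+ M in
                (one :- (β :+ one) :* N) :+ (((β :+ one) :* (x :+ C) :+ β) :+
                ((β :+ one) :* (M :* P :+ K :* N :- C) :+
                 (M :+ M :* (β :- (β :+ one) :* (P :+ N))))) :=
                (β :+ one) :* (x :+ K))
                ≈-refl β x C M P N)
            (0<x⇒0≤y⇒0<x+y [β+1]negatives<1 (0≤-+ lower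
              (0≤-+ (0≤-* 0≤β+1 (combination-≤ (suc m) m 1# a h b))
                (0≤-+ (0≤n×1 m) (0≤-* (0≤n×1 m) (inj₁ [β+1]absolutes<β))))))))
            (below (λ j j<d → Between-weaken ℕ.≤-refl (ℕ.n≤1+n m) (b j j<d)))

        lattice-0 : ∀ {z} → RepresentedBy InLattice (suc d) (Between 0 0) z → z ≈ 0#
        lattice-0 {z} (h , inLattice z∈ , b) = begin
          z                                          ≈⟨ z∈ ⟩
          fromℤ (h 0) + combination 1# a (h ∘ suc)
            ≈⟨ +-cong (reflexive (≡.cong fromℤ (h≡0 0 ℕ.z<s)))
                                                          (combination-0 1# a (h ∘ suc) (λ j j<d → h≡0 (suc j) (ℕ.s<s j<d))) ⟩
          0# + 0#                                    ≈⟨ +-identityʳ 0# ⟩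
          0#                                         ∎
          where
          h≡0 : ∀ j → j ℕ.< suc d → h j ≡ 0ℤ
          h≡0 j j<d = ℤ.≤-antisym (proj₂ (b j j<d)) (proj₁ (b j j<d))

        lattice-vanishes : ∀ {z h} → InLattice z h → ∃ λ k → fold z T₋ᵦ k ≈ 0#
        lattice-vanishes {z} {h} z∈ =
          let m , b = Between-bound (suc d) h
              k , Tz∈ = descent InLattice T₋ᵦ T₋ᵦ-lattice Between-wide Between-narrow m (h , z∈ , b)
          in k , lattice-0 Tz∈

        -- From the lattice to all of ℤ[β⁻¹].

        Lattice : Carrier → Set ℓ₁
        Lattice z = ∃ (InLattice z)

        lattice-resp : ∀ {y z} → y ≈ z → Lattice y → Lattice z
        lattice-resp y≈z (h , inLattice y∈) = h , inLattice (trans (sym y≈z) y∈)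

        lattice-fromℤ : ∀ i → Lattice (fromℤ i)
        lattice-fromℤ i = (i ∷ₛ λ _ → 0ℤ) , inLattice (begin
          fromℤ i                                ≈⟨ +-identityʳ _ ⟨
          fromℤ i + 0#
            ≈⟨ +-congˡ (combination-0 1# a (λ _ → 0ℤ) (λ _ _ → ≡.refl)) ⟨
          fromℤ i + combination 1# a (λ _ → 0ℤ)  ∎)

        lattice-minus : ∀ {y z} → Lattice y → Lattice z → Lattice (y - z)
        lattice-minus {y} {z} (g , inLattice y∈) (h , inLattice z∈) = (λ j → g j ℤ.- h j) ,
            inLattice (begin
          y - z                                        ≈⟨ +-cong y∈ (-‿cong z∈) ⟩
          fromℤ (g 0) + G - (fromℤ (h 0) + H)
            ≈⟨ solve 4 (λ g G h H → g :+ G :- (h :+ H) := g :- h :+ (G :- H))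
                                                            ≈-refl (fromℤ (g 0)) G (fromℤ (h 0)) H ⟩
          fromℤ (g 0) - fromℤ (h 0) + (G - H)
            ≈⟨ +-cong (fromℤ-minus (g 0) (h 0)) (combination-minus 1# a (g ∘ suc) (h ∘ suc)) ⟨
          fromℤ (g 0 ℤ.- h 0) + combination 1# a (λ j → g (suc j) ℤ.- h (suc j)) ∎)
          where
          G = combination 1# a (g ∘ suc)
          H = combination 1# a (h ∘ suc)

        lattice-[-β]* : ∀ {z} → Lattice z → Lattice (- β * z)
        lattice-[-β]* (h , z∈) = (ℤ.- dot a h ∷ₛ h) , inLattice (multiply-lattice z∈)

        lattice-[-β]^* : ∀ k {z} → Lattice z → Lattice ((- β) ^ k * z)
        lattice-[-β]^* zero    z∈ = lattice-resp (sym (*-identityˡ _)) z∈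
        lattice-[-β]^* (suc k) z∈ =
          lattice-resp (sym (*-assoc _ _ _)) (lattice-[-β]* (lattice-[-β]^* k z∈))

        -- With B = (-β)^length cs and E the value of the tail, -β B (i + β⁻¹ E) = -β B i - B E, so
        -- subtraction and multiplication by -β suffice.
        clear-denominators : ∀ cs → Lattice ((- β) ^ length cs * evaluate cs (β ⁻¹))
        clear-denominators []       = lattice-resp (sym (*-identityˡ 0#)) (lattice-fromℤ 0ℤ)
        clear-denominators (i ∷ cs) = lattice-resp
          (begin
            - β * B * fromℤ i - B * E                      ≈⟨ +-congˡ (-‿cong (*-identityˡ _)) ⟨
            - β * B * fromℤ i - 1# * (B * E)
              ≈⟨ +-congˡ (-‿cong (*-congʳ (⁻¹-inverseʳ (λ eq → STO.irrefl (sym eq) 0<β)))) ⟨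
            - β * B * fromℤ i - β * β ⁻¹ * (B * E)         ≈⟨ solve 5 (λ β B i c E →
                (:- β) :* B :* i :- β :* c :* (B :* E) := (:- β) :* B :* (i :+ c :* E))
                    ≈-refl β B (fromℤ i) (β ⁻¹) E ⟩
            - β * B * (fromℤ i + β ⁻¹ * E)                 ∎)
          (lattice-minus (lattice-[-β]^* (suc (length cs)) (lattice-fromℤ i)) (clear-denominators cs))
          where
          B = (- β) ^ length cs
          E = evaluate cs (β ⁻¹)

        -- The transformation itself supplies one factor -β, and the subtracted digit times (-β)ᵏ
        -- lies in the lattice.
        T₋ᵦ-lattice-descend : ∀ k {z} → Lattice ((- β) ^ suc k * z) → Lattice ((- β) ^ k * T₋ᵦ z)
        T₋ᵦ-lattice-descend k {z} z∈ = lattice-resp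
          (solve 4 (λ β B z f → (:- β) :* B :* z :- B :* f := B :* ((:- β) :* z :- f))
              ≈-refl β B z (fromℤ f))
          (lattice-minus z∈ (lattice-[-β]^* k (lattice-fromℤ f)))
          where
          B = (- β) ^ k
          f = ⌊ - β * z - ℓᵦ ⌋

        scaled-lattice : ∀ x l k → Lattice ((- β) ^ l * x) → Lattice ((- β) ^ (l ℕ.+ k) * scaled x k)
        scaled-lattice x l k = lattice-resp (sym (begin
          (- β) ^ (l ℕ.+ k) * (x * g ⁻¹)   ≈⟨ *-congʳ (^-homo-* (- β) l k) ⟩
          (- β) ^ l * g * (x * g ⁻¹)
            ≈⟨ solve 4 (λ B g x c → B :* g :* (x :* c) := B :* x :* (g :* c))
                ≈-refl ((- β) ^ l) g x (g ⁻¹) ⟩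
          (- β) ^ l * x * (g * g ⁻¹)       ≈⟨ *-congˡ (⁻¹-inverseʳ ([-β]^n≉0 k)) ⟩
          (- β) ^ l * x * 1#               ≈⟨ *-identityʳ _ ⟩
          (- β) ^ l * x                    ∎))
          where g = (- β) ^ k

        -- Two phases: the orbit first enters the lattice, then the descent on coefficients brings
        -- it to 0.
        orbit-vanishes : ∀ k {z} → Lattice ((- β) ^ k * z) → ∃ λ m → fold z T₋ᵦ m ≈ 0#
        orbit-vanishes k {z} z∈ =
          let m , q = fold-descend T₋ᵦ (λ k z → Lattice ((- β) ^ k * z)) T₋ᵦ-lattice-descend k z∈
              h , Tz∈ = lattice-resp (*-identityˡ _) q
              m′ , T≈0 = lattice-vanishes Tz∈
          in m′ ℕ.+ m , ≡.subst (_≈ 0#) (≡.sym (fold-+ z T₋ᵦ m′)) T≈0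

        propertyMinusF : PropertyMinusF
        propertyMinusF x (cs , x≈) =
          let k , minimal = minimalExponent x
              -- `length cs` factors clear the denominators of `x`, and `k` more undo the scaling.
              m , T≈0 = orbit-vanishes (length cs ℕ.+ k) {scaled x k} (scaled-lattice x (length cs) k
                (lattice-resp (*-congˡ (sym x≈)) (clear-denominators cs)))
          in k , minimal , finitelyManyNonzero x k {m} T≈0

theorem4 : ∀ {c ℓ₁ ℓ₂} (ℝ : RealNumbers c ℓ₁ ℓ₂) →
    let open RealNumbers ℝ in
    (β : Carrier) → 1# < β →
    ∀ {n : ℕ} (a : Vector ℤ (suc n)) →
    alternatingPolynomial a β ≈ 0# →
    (∀ i → 0ℤ ℤ.≤ a i) →
    + 2 ℤ.+ sumℤ (tail a) ℤ.≤ head a →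
    NegativeBase.PropertyMinusF ℝ β
theorem4 ℝ β 1<β a root 0≤a dominant =
  propertyMinusF ℝ β 1<β a (alternatingPolynomial-root ℝ β a root) 0≤a dominant
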